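{- The Boros-Moll sequences $\{d_i(m)\}_{0\le i\le m}$ are $2$-log-concave; that is, for all integers $m,i$ with $1\leq i\leq m-1$, $$\frac{d_{i-1}^{2}(m)-d_{i-2}(m)d_{i}(m)}{d_{i}^{2}(m)-d_{i-1}(m)d_{i+1}(m)} < \frac{d_{i}^{2}(m)-d_{i-1}(m)d_{i+1}(m)}{d_{i+1}^{2}(m)-d_{i}(m)d_{i+2}(m)}.$$
   Context: For integers $m\ge 0$ and $0\le i\le m$, the Boros-Moll numbers are $$d_i(m)=2^{ -2m}\sum_{k=i}^m 2^k\binom{2m-2k}{m-k}\binom{m+k}{k}\binom{k}{i},$$ with the convention $d_i(m)=0$ for $i<0$ or $i>m$. They are the coefficients of the Boros-Moll polynomial $P_m(a)=\sum_{i=0}^m d_i(m)a^i$. The notation $d_i^{2}(m)$ means $(d_i(m))^2$. A finite real sequence $\{a_i\}_{0\le i\le n}$ (with $a_{ -1}=a_{n+1}=0$) is log-concave if $a_i^2-a_{i+1}a_{i-1}\ge 0$ for $1\le i\le n$. Let $\mathcal L(\{a_i\}_{0\le i\le n})=\{b_i\}_{0\le i\le n}$ with $b_i=a_i^2-a_{i-1}a_{i+1}$. The sequence is $k$-log-concave if $\mathcal L^j(\{a_i\})$ is log-concave for every $0\le j\le k-1$. -}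

module Defs where

open import Data.Fin.Base using (Fin; toℕ; fromℕ<)
open import Data.Integer.Base as ℤ using (ℤ; +_; -[1+_])
open import Data.List.Base using (applyUpTo)
open import Data.Nat.Base as ℕ using (ℕ; suc; _∸_; _^_)
open import Data.Nat.Combinatorics using (_C_)
open import Data.Nat.GeneralisedArithmetic using (fold)
open import Data.Nat.ListAction using (sum)
open import Data.Nat.Properties using (_<?_; m^n≢0)
open import Data.Rational.Base as ℚ using (ℚ; 0ℚ; _/_; _*_; _-_)
open import Relation.Nullary.Decidable.Core using (yes; no)

-- f i + f (i + 1) + ⋯ + f m, which is the empty sum when i > m.
sumFromTo : ℕ → ℕ → (ℕ → ℕ) → ℕ
sumFromTo i m f = sum (applyUpTo (λ j → f (i ℕ.+ j)) (suc m ∸ i))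

-- The Boros-Moll number d_i(m), with i ranging over ℤ.  For i > m the sum is
-- empty, so the convention d_i(m) = 0 holds there as well as for i < 0.
-- The truncated subtractions are exact because k ≤ m in every summand.
d : ℕ → ℤ → ℚ
d m -[1+ _ ] = 0ℚ
d m (+ i)    = (+ numerator / 2 ^ (2 ℕ.* m)) {{m^n≢0 2 (2 ℕ.* m)}}
  where
  numerator : ℕ
  numerator = sumFromTo i m λ k →
    2 ^ k ℕ.* ((2 ℕ.* m ∸ 2 ℕ.* k) C (m ∸ k)) ℕ.* ((m ℕ.+ k) C k) ℕ.* (k C i)

-- A finite sequence a_0, …, a_n.
FinSeq : ℕ → Set
FinSeq n = Fin (suc n) → ℚ

-- Extension by zero, giving in particular a_{-1} = a_{n+1} = 0.
extend : ∀ {n} → FinSeq n → ℤ → ℚ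
extend a -[1+ _ ] = 0ℚ
extend {n} a (+ i) with i <? suc n
... | yes i<1+n = a (fromℕ< i<1+n)
... | no _      = 0ℚ

-- a_i² − a_{i-1} a_{i+1}
turán : (ℤ → ℚ) → ℤ → ℚ
turán a i = a i * a i - a (i ℤ.- + 1) * a (i ℤ.+ + 1)

LogConcave : ∀ {n} → FinSeq n → Set
LogConcave {n} a = ∀ i → 1 ℕ.≤ i → i ℕ.≤ n → 0ℚ ℚ.≤ turán (extend a) (+ i)

𝓛 : ∀ {n} → FinSeq n → FinSeq n
𝓛 a i = turán (extend a) (+ toℕ i)

_-LogConcave_ : ℕ → ∀ {n} → FinSeq n → Set
k -LogConcave a = ∀ j → j ℕ.< k → LogConcave (fold a 𝓛 j)

borosMoll : (m : ℕ) → FinSeq m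
borosMoll m i = d m (+ toℕ i)

module Submission where

-- For fixed m the q_i = i! d_i(m) = P_m^{(i)}(0) satisfy a three-term recurrence
--   (m - i)(m + i + 1) q_i = (2m + 1) q_{i+1} - q_{i+2},
-- so the ratios t_i = q_{i+1} / q_i obey t_i = (m - i)(m + i + 1) / (2m + 1 - t_{i+1}) with t_m = 0.
-- The right-hand side is increasing in t_{i+1}, and (m - i)(2i + 2)/(2i + 3) ≤ t_i ≤ m - i follows by
-- downward induction on i.  By the recurrence, D₀² - D₋ D₊ is a quartic form in (d_{i-1}, d_i); in
-- coordinates that are the two slacks of the bounds on t_{i-1}, all its coefficients, as polynomials
-- in i - 1 and m - i - 1, are nonnegative.

open import Defs
open import Data.Bool.Base using (Bool; true; _∧_; T)
open import Data.Bool.Properties using (T-∧)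
open import Data.Fin.Base using (toℕ; fromℕ<)
open import Data.Fin.Patterns using (0F; 1F; 2F; 3F)
open import Data.Fin.Properties using (toℕ-fromℕ<)
open import Data.Integer.Base as ℤ using (ℤ; +_; -[1+_]; 0ℤ; 1ℤ)
import Data.Integer.Properties as ℤ
open import Data.Integer.Solver using (module +-*-Solver)
import Data.Integer.Tactic.RingSolver as ℤ-Tactic
open import Data.List.Base using (applyUpTo)
open import Data.Nat.Base as ℕ using (ℕ; zero; suc; z≤n; s≤s)
open import Data.Nat.Combinatorics using (_C_; nCk+nC[k+1]≡[n+1]C[k+1]; nC1≡n; k>n⇒nCk≡0)
open import Data.Nat.ListAction using (sum)
import Data.Nat.Properties as ℕ
open import Data.Nat.Tactic.RingSolver using (solve-∀)
open import Data.Product.Base using (_×_; _,_; proj₁; proj₂; Σ-syntax)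
open import Data.Sum.Base using (inj₁; inj₂)
open import Data.Unit.Base using (tt)
open import Data.Vec.Base using (Vec; []; _∷_; map)
open import Function.Bundles using (Equivalence)
open import Relation.Binary.PropositionalEquality
open import Relation.Nullary.Decidable.Core using (yes; no)
open import Relation.Nullary.Negation.Core using (contradiction)

-- The recurrence is the i-th derivative at a = 0 of the Jacobi-type differential equation (1 - a²)
-- P'' - (2m + 1 + 2a) P' + m (m + 1) P = 0; below it is derived from the defining sum by
-- telescoping. Applied at i - 2, i - 1 and i, it reduces the five Boros-Moll numbers in the
-- inequality to two, so that what remains is a claim about the single ratio d_i(m) / d_{i-1}(m).
-- The two bounds confine the pair (d_{i-1}, d_i) to a cone whose sides are the axes of the slack
-- coordinates, which is why positivity on it can be read off from coefficients. The expanded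
-- quartic is too long for a certificate written by hand, so its coefficients are computed and
-- checked by evaluation. Every inequality involved is homogeneous in the d_i(m), whose common
-- denominator 4^m does not depend on i. The argument therefore runs in ℤ on the numerators and
-- returns to ℚ only at the end.

module IntegerOrder where
  open import Data.Integer.Base using (_+_; _*_; _-_; _≤_; _<_; +≤+)

  -- Makes the ring solver usable modulo hypotheses: the solver proves an identity that carries an
  -- explicit multiple of `a - b`, and this lemma then discards that multiple.
  cancelEq : ∀ {a b} r c → a ≡ b → r + c * (a - b) ≡ r
  cancelEq {a} r c refl = vanish a r c
    where
    vanish : ∀ a r c → r + c * (a - a) ≡ r
    vanish = ℤ-Tactic.solve-∀

  0≤* : ∀ {a b} → 0ℤ ≤ a → 0ℤ ≤ b → 0ℤ ≤ a * b
  0≤* {a} {b} 0≤a 0≤b = subst (_≤ a * b) (ℤ.*-zeroʳ a) (ℤ.*-monoˡ-≤-nonNeg a {{ℤ.nonNegative 0≤a}} 0≤b)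

  0<* : ∀ {a b} → 0ℤ < a → 0ℤ < b → 0ℤ < a * b
  0<* {a} {b} 0<a 0<b = subst (_< a * b) (ℤ.*-zeroʳ a) (ℤ.*-monoˡ-<-pos a {{ℤ.positive 0<a}} 0<b)

  0≤+n : ∀ {n} → 0ℤ ≤ + n
  0≤+n = +≤+ ℕ.z≤n

  0<i-j⇒j<i : ∀ {i j} → 0ℤ < i - j → j < i
  0<i-j⇒j<i {i} {j} h = subst₂ _<_ (ℤ.+-identityʳ j) (shift i j) (ℤ.+-monoʳ-< j h)
    where
    shift : ∀ i j → j + (i - j) ≡ i
    shift = ℤ-Tactic.solve-∀

  0≤-cancelˡ : ∀ k {a} → 0ℤ ≤ + suc k * a → 0ℤ ≤ a
  0≤-cancelˡ k {a} 0≤ka = ℤ.*-cancelˡ-≤-pos 0ℤ a (+ suc k)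
    (subst (_≤ + suc k * a) (sym (ℤ.*-zeroʳ (+ suc k))) 0≤ka)

open IntegerOrder

-- The normal forms of the ring solver are Horner forms, so that all coefficients are nonnegative can be
-- checked by evaluation.
module NonNegativeCoefficients where
  open +-*-Solver

  mutual
    nonNegH : ∀ {n} → HNF n → Bool
    nonNegH ∅         = true
    nonNegH (p *x+ c) = nonNegH p ∧ nonNegN c

    nonNegN : ∀ {n} → Normal n → Bool
    nonNegN (con c)  = 0ℤ ℤ.≤ᵇ c
    nonNegN (poly p) = nonNegH p

  mutual
    -- The valuation consists of naturals, so each Horner step multiplies by some x ≥ 0 and adds a
    -- nonnegative value.
    nonNegH-sound : ∀ {n} (p : HNF (suc n)) → T (nonNegH p) → (ρ : Vec ℕ (suc n)) → 0ℤ ℤ.≤ ⟦ p ⟧H (map +_ ρ)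
    nonNegH-sound ∅         _ _       = ℤ.≤-refl
    nonNegH-sound (p *x+ c) h (x ∷ ρ) with hp , hc ← Equivalence.to T-∧ h =
      ℤ.+-mono-≤ (ℤ.*-monoʳ-≤-nonNeg (+ x) (nonNegH-sound p hp (x ∷ ρ))) (nonNegN-sound c hc ρ)

    nonNegN-sound : ∀ {n} (p : Normal n) → T (nonNegN p) → (ρ : Vec ℕ n) → 0ℤ ℤ.≤ ⟦ p ⟧N (map +_ ρ)
    nonNegN-sound (con c)  h _ = ℤ.≤ᵇ⇒≤ h
    nonNegN-sound (poly p) h ρ = nonNegH-sound p h ρ

  nonNegCoeffs⇒nonNeg : ∀ {n} (p : Polynomial n) → T (nonNegN (normalise p)) →
    (ρ : Vec ℕ n) → 0ℤ ℤ.≤ ⟦ p ⟧ (map +_ ρ)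
  nonNegCoeffs⇒nonNeg p h ρ =
    subst (0ℤ ℤ.≤_) (correct p (map +_ ρ)) (nonNegN-sound (normalise p) h ρ)

open NonNegativeCoefficients

-- Slack coordinates and the quartic form.

module QuarticForm where

  record Arithmetic : Set₁ where
    infixl 6 _+_ _-_
    infixl 7 _*_
    field
      A           : Set
      _+_ _*_ _-_ : A → A → A
      κ           : ℕ → A

  -- Here i = j + 1 and m = i + y + 1, so that x = m - i + 1 and n = 2m + 1; p and r are the slacks
  -- (2i + 1) a₂ - 2x a₁ and x a₁ - i a₂ of the bounds on a₂ / a₁, where aₖ = 4^m d_{i-2+k}(m).
  -- Then c₀, …, c₄ are a₀, …, a₄ and δ₋, δ₀, δ₊, δ are D₋, D₀, D₊, D₀² - D₋ D₊ after clearing denominators.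
  -- The arithmetic is abstract because the same terms are needed as syntax and as integers.
  module Terms (𝔸 : Arithmetic) (j y p r : Arithmetic.A 𝔸) where
    open Arithmetic 𝔸

    i x n s c₀ c₁ c₂ c₃ c₄ δ₋ δ₀ δ₊ δ : A
    i  = κ 1 + j
    x  = κ 2 + y
    n  = κ 2 * (κ 2 + (y + j)) + κ 1
    s  = (x + κ 1) * (κ 2 * i + y)
    c₁ = i * p + (κ 2 * i + κ 1) * r
    c₂ = p + κ 2 * r
    c₃ = i * x * p + (κ 2 * i - κ 1) * (x - κ 1) * r
    c₀ = j * (n * c₁ - i * x * c₂)
    c₄ = n * c₃ - i * (x - κ 1) * (κ 2 * i + x) * c₂
    δ₋ = s * (c₁ * c₁) - x * (c₀ * c₂)
    δ₀ = x * i * (i + κ 1) * (c₂ * c₂) - c₁ * c₃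
    δ₊ = (i + κ 2) * (c₃ * c₃) - i * (i + κ 1) * (c₂ * c₄)
    δ  = s * (i + κ 2) * (δ₀ * δ₀) - δ₋ * δ₊

  private
    open +-*-Solver

    symbolic : Arithmetic
    symbolic = record { A = Polynomial 4; _+_ = _:+_; _*_ = _:*_; _-_ = _:-_; κ = λ c → con (+ c) }

    integral : Arithmetic
    integral = record { A = ℤ; _+_ = ℤ._+_; _*_ = ℤ._*_; _-_ = ℤ._-_; κ = +_ }

    module Sym = Terms symbolic (var 0F) (var 1F) (var 2F) (var 3F)
    module Int = Terms integral

  -- The coefficients remain nonnegative after subtracting c₂⁴, which makes the inequality strict.
  δ≥c₂⁴ : ∀ j y p r → let open Int (+ j) (+ y) (+ p) (+ r) in
    0ℤ ℤ.≤ δ ℤ.- c₂ ℤ.* c₂ ℤ.* (c₂ ℤ.* c₂)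
  δ≥c₂⁴ j y p r = nonNegCoeffs⇒nonNeg (δ :- c₂ :* c₂ :* (c₂ :* c₂)) tt (j ∷ y ∷ p ∷ r ∷ [])
    where
    open Sym
    open +-*-Solver

  open import Data.Integer.Base using (_+_; _*_; _-_; _≤_; _<_)
  open ≡-Reasoning

  module _ (j y p r : ℤ) {a₀ a₁ a₂ a₃ a₄ : ℤ} where
    open Int j y p r

    module _
      (rec₀ : s * a₀ ≡ j * (n * a₁ - i * a₂))
      (rec₁ : x * (+ 2 * i + y + + 1) * a₁ ≡ i * (n * a₂ - (i + + 1) * a₃))
      (rec₂ : (x - + 1) * (+ 2 * i + x) * a₂ ≡ (i + + 1) * (n * a₃ - (i + + 2) * a₄))
      (p≡ : (+ 2 * i + + 1) * a₂ - + 2 * x * a₁ ≡ p)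
      (r≡ : x * a₁ - i * a₂ ≡ r)
      where

      -- Adding twice the second slack to the first eliminates a₁. The bounds say that x a₁ / a₂
      -- lies between i and i + 1/2; since (2i + 1) · 1 - 2 · i = 1, passing from (x a₁, a₂) to the
      -- slacks is unimodular and creates no denominators.
      a₂≡c₂ : a₂ ≡ c₂
      a₂≡c₂ = trans (ring j y a₁ a₂) (cong₂ (λ p r → p + + 2 * r) p≡ r≡)
        where
        ring : ∀ j y a₁ a₂ → let i = + 1 + j; x = + 2 + y in
          a₂ ≡ ((+ 2 * i + + 1) * a₂ - + 2 * x * a₁) + + 2 * (x * a₁ - i * a₂)
        ring = ℤ-Tactic.solve-∀

      private
        e₁ : x * a₁ ≡ c₁
        e₁ = trans (ring j y a₁ a₂) (cong₂ (λ p r → i * p + (+ 2 * i + + 1) * r) p≡ r≡)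
          where
          ring : ∀ j y a₁ a₂ → let i = + 1 + j; x = + 2 + y in
            x * a₁ ≡ i * ((+ 2 * i + + 1) * a₂ - + 2 * x * a₁) + (+ 2 * i + + 1) * (x * a₁ - i * a₂)
          ring = ℤ-Tactic.solve-∀

        e₃ : i * (i + + 1) * a₃ ≡ c₃
        e₃ = begin
          _  ≡⟨ ring j y a₁ a₂ a₃ ⟩
          _  ≡⟨ cancelEq _ (+ 1) rec₁ ⟩
          _  ≡⟨ cong₂ (λ p r → i * x * p + (+ 2 * i - + 1) * (x - + 1) * r) p≡ r≡ ⟩
          c₃ ∎
          where
          ring : ∀ j y a₁ a₂ a₃ → let i = + 1 + j; x = + 2 + y; n = + 2 * (+ 2 + (y + j)) + + 1 in
            i * (i + + 1) * a₃ ≡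
            i * x * ((+ 2 * i + + 1) * a₂ - + 2 * x * a₁) + (+ 2 * i - + 1) * (x - + 1) * (x * a₁ - i * a₂)
            + + 1 * (x * (+ 2 * i + y + + 1) * a₁ - i * (n * a₂ - (i + + 1) * a₃))
          ring = ℤ-Tactic.solve-∀

        e₀ : x * s * a₀ ≡ c₀
        e₀ = begin
          x * s * a₀                         ≡⟨ ℤ.*-assoc x s a₀ ⟩
          x * (s * a₀)                       ≡⟨ cong (x *_) rec₀ ⟩
          x * (j * (n * a₁ - i * a₂))        ≡⟨ ring j i x n a₁ a₂ ⟩
          j * (n * (x * a₁) - i * x * a₂)    ≡⟨ cong₂ (λ u v → j * (n * u - i * x * v)) e₁ a₂≡c₂ ⟩
          c₀ ∎
          where
          ring : ∀ j i x n a₁ a₂ → x * (j * (n * a₁ - i * a₂)) ≡ j * (n * (x * a₁) - i * x * a₂)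
          ring = ℤ-Tactic.solve-∀

        e₄ : i * (i + + 1) * (i + + 2) * a₄ ≡ c₄
        e₄ = begin
          _  ≡⟨ ring i x n a₂ a₃ a₄ ⟩
          _  ≡⟨ cancelEq _ i rec₂ ⟩
          _  ≡⟨ cong₂ (λ u v → n * u - i * (x - + 1) * (+ 2 * i + x) * v) e₃ a₂≡c₂ ⟩
          c₄ ∎
          where
          ring : ∀ i x n a₂ a₃ a₄ → i * (i + + 1) * (i + + 2) * a₄ ≡
            n * (i * (i + + 1) * a₃) - i * (x - + 1) * (+ 2 * i + x) * a₂
            + i * ((x - + 1) * (+ 2 * i + x) * a₂ - (i + + 1) * (n * a₃ - (i + + 2) * a₄))
          ring = ℤ-Tactic.solve-∀

        d₋ d₀ d₊ k₋ k₀ k₊ : ℤ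
        d₋ = a₁ * a₁ - a₀ * a₂
        d₀ = a₂ * a₂ - a₁ * a₃
        d₊ = a₃ * a₃ - a₂ * a₄
        k₋ = x * x * s
        k₀ = x * i * (i + + 1)
        k₊ = i * (i + + 1) * (i * (i + + 1)) * (i + + 2)

        f₋ : k₋ * d₋ ≡ δ₋
        f₋ = begin
          k₋ * d₋                                             ≡⟨ ring x s a₀ a₁ a₂ ⟩
          s * (x * a₁ * (x * a₁)) - x * (x * s * a₀ * a₂)     ≡⟨ cong₂ (λ u v → s * (u * u) - x * (v * a₂)) e₁ e₀ ⟩
          s * (c₁ * c₁) - x * (c₀ * a₂)                       ≡⟨ cong (λ u → s * (c₁ * c₁) - x * (c₀ * u)) a₂≡c₂ ⟩
          δ₋ ∎
          where
          ring : ∀ x s a₀ a₁ a₂ → x * x * s * (a₁ * a₁ - a₀ * a₂)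
            ≡ s * (x * a₁ * (x * a₁)) - x * (x * s * a₀ * a₂)
          ring = ℤ-Tactic.solve-∀

        f₀ : k₀ * d₀ ≡ δ₀
        f₀ = begin
          k₀ * d₀                                             ≡⟨ ring x i a₁ a₂ a₃ ⟩
          k₀ * (a₂ * a₂) - x * a₁ * (i * (i + + 1) * a₃)      ≡⟨ cong₂ (λ u v → k₀ * (u * u) - x * a₁ * v) a₂≡c₂ e₃ ⟩
          k₀ * (c₂ * c₂) - x * a₁ * c₃                        ≡⟨ cong (λ u → k₀ * (c₂ * c₂) - u * c₃) e₁ ⟩
          δ₀ ∎
          where
          ring : ∀ x i a₁ a₂ a₃ → x * i * (i + + 1) * (a₂ * a₂ - a₁ * a₃)
            ≡ x * i * (i + + 1) * (a₂ * a₂) - x * a₁ * (i * (i + + 1) * a₃)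
          ring = ℤ-Tactic.solve-∀

        f₊ : k₊ * d₊ ≡ δ₊
        f₊ = begin
          k₊ * d₊
            ≡⟨ ring i a₂ a₃ a₄ ⟩
          (i + + 2) * (i * (i + + 1) * a₃ * (i * (i + + 1) * a₃)) - i * (i + + 1) * (a₂ * (i * (i + + 1) * (i + + 2) * a₄))
            ≡⟨ cong₂ (λ u v → (i + + 2) * (u * u) - i * (i + + 1) * (a₂ * v)) e₃ e₄ ⟩
          (i + + 2) * (c₃ * c₃) - i * (i + + 1) * (a₂ * c₄)
            ≡⟨ cong (λ u → (i + + 2) * (c₃ * c₃) - i * (i + + 1) * (u * c₄)) a₂≡c₂ ⟩
          δ₊ ∎
          where
          ring : ∀ i a₂ a₃ a₄ → i * (i + + 1) * (i * (i + + 1)) * (i + + 2) * (a₃ * a₃ - a₂ * a₄)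
            ≡ (i + + 2) * (i * (i + + 1) * a₃ * (i * (i + + 1) * a₃))
              - i * (i + + 1) * (a₂ * (i * (i + + 1) * (i + + 2) * a₄))
          ring = ℤ-Tactic.solve-∀

      -- `k₋ * k₊` equals `s * (i + 2)` times `k₀ * k₀`; this explains the factor in front of
      -- `δ₀ * δ₀` in `δ`, and one positive constant then scales both sides of the inequality.
      scaled≡δ : k₋ * k₊ * (d₀ * d₀) - k₋ * k₊ * (d₋ * d₊) ≡ δ
      scaled≡δ = begin
        k₋ * k₊ * (d₀ * d₀) - k₋ * k₊ * (d₋ * d₊)
          ≡⟨ ring x i s d₋ d₀ d₊ ⟩
        s * (i + + 2) * (k₀ * d₀ * (k₀ * d₀)) - k₋ * d₋ * (k₊ * d₊)
          ≡⟨ cong₂ (λ u v → s * (i + + 2) * (u * u) - v * (k₊ * d₊)) f₀ f₋ ⟩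
        s * (i + + 2) * (δ₀ * δ₀) - δ₋ * (k₊ * d₊)
          ≡⟨ cong (λ u → s * (i + + 2) * (δ₀ * δ₀) - δ₋ * u) f₊ ⟩
        δ ∎
        where
        ring : ∀ x i s d₋ d₀ d₊ →
          x * x * s * (i * (i + + 1) * (i * (i + + 1)) * (i + + 2)) * (d₀ * d₀)
            - x * x * s * (i * (i + + 1) * (i * (i + + 1)) * (i + + 2)) * (d₋ * d₊)
          ≡ s * (i + + 2) * (x * i * (i + + 1) * d₀ * (x * i * (i + + 1) * d₀))
            - x * x * s * d₋ * (i * (i + + 1) * (i * (i + + 1)) * (i + + 2) * d₊)
        ring = ℤ-Tactic.solve-∀

  module _ (j y : ℕ) {a₀ a₁ a₂ a₃ a₄ : ℤ} where
    private
      i x n : ℤ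
      i = + 1 + + j
      x = + 2 + + y
      n = + 2 * (+ 2 + (+ y + + j)) + + 1

    module _
      (rec₀ : (x + + 1) * (+ 2 * i + + y) * a₀ ≡ + j * (n * a₁ - i * a₂))
      (rec₁ : x * (+ 2 * i + + y + + 1) * a₁ ≡ i * (n * a₂ - (i + + 1) * a₃))
      (rec₂ : (x - + 1) * (+ 2 * i + x) * a₂ ≡ (i + + 1) * (n * a₃ - (i + + 2) * a₄))
      where

      private
        0<scaled : ∀ p r → (+ 2 * i + + 1) * a₂ - + 2 * x * a₁ ≡ + p → x * a₁ - i * a₂ ≡ + r → 0ℤ < a₂ →
          0ℤ < Int.δ (+ j) (+ y) (+ p) (+ r)
        0<scaled p r p≡ r≡ 0<a₂ = ℤ.<-≤-trans
          (0<* (0<* 0<c₂ 0<c₂) (0<* 0<c₂ 0<c₂))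
          (ℤ.0≤i-j⇒j≤i (δ≥c₂⁴ j y p r))
          where
          0<c₂ = subst (0ℤ <_) (a₂≡c₂ (+ j) (+ y) (+ p) (+ r) rec₀ rec₁ rec₂ p≡ r≡) 0<a₂

      turánProduct<turán² : 0ℤ ≤ (+ 2 * i + + 1) * a₂ - + 2 * x * a₁ → 0ℤ ≤ x * a₁ - i * a₂ → 0ℤ < a₂ →
        (a₁ * a₁ - a₀ * a₂) * (a₃ * a₃ - a₂ * a₄) < (a₂ * a₂ - a₁ * a₃) * (a₂ * a₂ - a₁ * a₃)
      turánProduct<turán² 0≤p 0≤r 0<a₂ = ℤ.*-cancelˡ-<-nonNeg k
        (0<i-j⇒j<i (subst (0ℤ <_)
          (sym (scaled≡δ (+ j) (+ y) _ _ rec₀ rec₁ rec₂ p≡ r≡))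
          (0<scaled _ _ p≡ r≡ 0<a₂)))
        where
        -- Nonnegative slacks are naturals, which is the form the coefficient check accepts.
        p≡ = sym (ℤ.0≤i⇒+∣i∣≡i 0≤p)
        r≡ = sym (ℤ.0≤i⇒+∣i∣≡i 0≤r)
        k = x * x * ((x + + 1) * (+ 2 * i + + y)) * (i * (i + + 1) * (i * (i + + 1)) * (i + + 2))

open QuarticForm using (turánProduct<turán²)

-- Recurrence, positivity and ratio bounds for the numerators.

module Numerators where
  open import Data.Nat.Base using (_+_; _*_; _∸_; _^_; _≤_; _<_)
  open import Data.Nat.Properties

  -- Binomial coefficients

  [k+1]*[n+1]C[k+1]≡[n+1]*nCk : ∀ n k → suc k * (suc n C suc k) ≡ suc n * (n C k)
  [k+1]*[n+1]C[k+1]≡[n+1]*nCk n zero = begin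
    1 * (suc n C 1) ≡⟨ *-identityˡ (suc n C 1) ⟩
    suc n C 1       ≡⟨ nC1≡n (suc n) ⟩
    suc n           ≡⟨ *-identityʳ (suc n) ⟨
    suc n * (n C 0) ∎
    where open ≡-Reasoning
  [k+1]*[n+1]C[k+1]≡[n+1]*nCk zero (suc k) = begin
    suc (suc k) * (1 C suc (suc k)) ≡⟨ cong (suc (suc k) *_) (k>n⇒nCk≡0 {1} {suc (suc k)} (s≤s (s≤s z≤n))) ⟩
    suc (suc k) * 0                 ≡⟨ *-zeroʳ (suc (suc k)) ⟩
    0                               ≡⟨ cong (1 *_) (k>n⇒nCk≡0 {0} {suc k} (s≤s z≤n)) ⟨
    1 * (0 C suc k)                 ∎
    where open ≡-Reasoning
  [k+1]*[n+1]C[k+1]≡[n+1]*nCk (suc n) (suc k) = begin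
    suc (suc k) * (suc (suc n) C suc (suc k))
      ≡⟨ cong (suc (suc k) *_) (nCk+nC[k+1]≡[n+1]C[k+1] (suc n) (suc k)) ⟨
    suc (suc k) * (a + (suc n C suc (suc k)))
      ≡⟨ *-distribˡ-+ (suc (suc k)) a (suc n C suc (suc k)) ⟩
    (a + suc k * a) + suc (suc k) * (suc n C suc (suc k))
      ≡⟨ cong₂ (λ u v → (a + u) + v) ([k+1]*[n+1]C[k+1]≡[n+1]*nCk n k) ([k+1]*[n+1]C[k+1]≡[n+1]*nCk n (suc k)) ⟩
    (a + suc n * (n C k)) + suc n * (n C suc k)
      ≡⟨ +-assoc a (suc n * (n C k)) (suc n * (n C suc k)) ⟩
    a + (suc n * (n C k) + suc n * (n C suc k))
      ≡⟨ cong (λ t → a + t) (*-distribˡ-+ (suc n) (n C k) (n C suc k)) ⟨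
    a + suc n * ((n C k) + (n C suc k))
      ≡⟨ cong (λ t → a + suc n * t) (nCk+nC[k+1]≡[n+1]C[k+1] n k) ⟩
    suc (suc n) * a ∎
    where
    open ≡-Reasoning
    a = suc n C suc k

  -- This is (k + 1) C(n, k + 1) = (n - k) C(n, k) with the subtraction moved across, so that it
  -- holds in ℕ for all n and k.
  [k+1]*nC[k+1]+k*nCk≡n*nCk : ∀ n k → suc k * (n C suc k) + k * (n C k) ≡ n * (n C k)
  [k+1]*nC[k+1]+k*nCk≡n*nCk n k = +-cancelˡ-≡ (n C k) _ _ (begin
    (n C k) + (suc k * (n C suc k) + k * (n C k)) ≡⟨ rearrange k (n C k) (n C suc k) ⟩
    suc k * ((n C k) + (n C suc k))               ≡⟨ cong (suc k *_) (nCk+nC[k+1]≡[n+1]C[k+1] n k) ⟩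
    suc k * (suc n C suc k)                       ≡⟨ [k+1]*[n+1]C[k+1]≡[n+1]*nCk n k ⟩
    suc n * (n C k)                               ∎)
    where
    open ≡-Reasoning
    rearrange : ∀ k a b → a + (suc k * b + k * a) ≡ suc k * (a + b)
    rearrange = solve-∀

  k≤n⇒nCk>0 : ∀ {n k} → k ≤ n → 0 < n C k
  k≤n⇒nCk>0 {n} {zero} _ = s≤s z≤n
  k≤n⇒nCk>0 {suc n} {suc k} (s≤s k≤n) =
    subst (0 <_) (nCk+nC[k+1]≡[n+1]C[k+1] n k) (≤-trans (k≤n⇒nCk>0 k≤n) (m≤m+n (n C k) (n C suc k)))

  centralBinomial-suc : ∀ j → suc j * (2 * suc j C suc j) ≡ 2 * (2 * j + 1) * (2 * j C j)
  centralBinomial-suc j = begin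
    suc j * (2 * suc j C suc j)           ≡⟨ cong (λ n → suc j * (n C suc j)) 2[j+1]≡2+2j ⟩
    suc j * (suc (suc (2 * j)) C suc j)   ≡⟨ [k+1]*[n+1]C[k+1]≡[n+1]*nCk (suc (2 * j)) j ⟩
    suc (suc (2 * j)) * (suc (2 * j) C j) ≡⟨ rearrange₁ j (suc (2 * j) C j) ⟩
    2 * (suc j * (suc (2 * j) C j))       ≡⟨ cong (2 *_) middle ⟨
    2 * (suc j * (suc (2 * j) C suc j))   ≡⟨ cong (2 *_) ([k+1]*[n+1]C[k+1]≡[n+1]*nCk (2 * j) j) ⟩
    2 * (suc (2 * j) * (2 * j C j))       ≡⟨ rearrange₂ j (2 * j C j) ⟩
    2 * (2 * j + 1) * (2 * j C j)         ∎
    where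
    open ≡-Reasoning
    2[j+1]≡2+2j : 2 * suc j ≡ suc (suc (2 * j))
    2[j+1]≡2+2j = *-suc 2 j
    rearrange₁ : ∀ j a → suc (suc (2 * j)) * a ≡ 2 * (suc j * a)
    rearrange₁ = solve-∀
    rearrange₂ : ∀ j a → 2 * (suc (2 * j) * a) ≡ 2 * (2 * j + 1) * a
    rearrange₂ = solve-∀
    rearrange₃ : ∀ j a → suc (2 * j) * a ≡ suc j * a + j * a
    rearrange₃ = solve-∀
    -- The symmetry C(2j + 1, j + 1) = C(2j + 1, j), multiplied by j + 1.
    middle : suc j * (suc (2 * j) C suc j) ≡ suc j * (suc (2 * j) C j)
    middle = +-cancelʳ-≡ (j * (suc (2 * j) C j)) _ _
      (trans ([k+1]*nC[k+1]+k*nCk≡n*nCk (suc (2 * j)) j) (rearrange₃ j (suc (2 * j) C j)))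

  -- Sums

  sum-applyUpTo-suc : ∀ f n → sum (applyUpTo f (suc n)) ≡ sum (applyUpTo f n) + f n
  sum-applyUpTo-suc f zero    = +-comm (f 0) 0
  sum-applyUpTo-suc f (suc n) = begin
    f 0 + sum (applyUpTo (λ k → f (suc k)) (suc n))           ≡⟨ cong (λ t → f 0 + t) (sum-applyUpTo-suc (λ k → f (suc k)) n) ⟩
    f 0 + (sum (applyUpTo (λ k → f (suc k)) n) + f (suc n))   ≡⟨ +-assoc (f 0) _ _ ⟨
    f 0 + sum (applyUpTo (λ k → f (suc k)) n) + f (suc n)     ∎
    where open ≡-Reasoning

  sum-drop-zeros : ∀ f i n → (∀ {k} → k < i → f k ≡ 0) →
    sum (applyUpTo (λ j → f (i + j)) (n ∸ i)) ≡ sum (applyUpTo f n)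
  sum-drop-zeros f zero    n       _  = refl
  sum-drop-zeros f (suc i) zero    _  = refl
  sum-drop-zeros f (suc i) (suc n) f≡0 = trans
    (sum-drop-zeros (λ k → f (suc k)) i n (λ k<i → f≡0 (s≤s k<i)))
    (cong (_+ sum (applyUpTo (λ k → f (suc k)) n)) (sym (f≡0 (s≤s z≤n))))

  -- The recurrence in i

  weight : ℕ → ℕ → ℕ
  weight m k = 2 ^ k * ((2 * m ∸ 2 * k) C (m ∸ k)) * ((m + k) C k)

  partialSum : ℕ → ℕ → ℕ → ℕ
  partialSum m i n = sum (applyUpTo (λ k → weight m k * (k C i)) n)

  -- The numerator of d_i(m) over 4^m.
  numer : ℕ → ℕ → ℕ
  numer m i = sumFromTo i m λ k → weight m k * (k C i)

  -- The recurrence compares sums with three different starting points; since C(k, i) = 0 for k < i,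
  -- all of them can be taken over 0 ≤ k ≤ m and combined termwise.
  numer≡partialSum : ∀ m i → numer m i ≡ partialSum m i (suc m)
  numer≡partialSum m i = sum-drop-zeros (λ k → weight m k * (k C i)) i (suc m)
    λ {k} k<i → trans (cong (weight m k *_) (k>n⇒nCk≡0 k<i)) (*-zeroʳ (weight m k))

  weight-explicit : ∀ {m} k j → k + j ≡ m → weight m k ≡ 2 ^ k * (2 * j C j) * ((m + k) C k)
  weight-explicit k j refl =
    cong₂ (λ a b → 2 ^ k * (a C b) * ((k + j + k) C k))
      (trans (sym (*-distribˡ-∸ 2 (k + j) k)) (cong (2 *_) (m+n∸m≡n k j)))
      (m+n∸m≡n k j)

  weight-suc : ∀ {m} k j → suc k + j ≡ m →
    suc k * (2 * j + 1) * weight m (suc k) ≡ suc j * suc (m + k) * weight m k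
  weight-suc {m} k j 1+k+j≡m = begin
    suc k * (2 * j + 1) * weight m (suc k)
      ≡⟨ cong (suc k * (2 * j + 1) *_) (weight-explicit (suc k) j 1+k+j≡m) ⟩
    suc k * (2 * j + 1) * (2 ^ suc k * (2 * j C j) * ((m + suc k) C suc k))
      ≡⟨ cong (λ n → suc k * (2 * j + 1) * (2 ^ suc k * (2 * j C j) * (n C suc k))) (+-suc m k) ⟩
    suc k * (2 * j + 1) * (2 ^ suc k * (2 * j C j) * (suc (m + k) C suc k))
      ≡⟨ rearrange₁ k j (2 ^ k) (2 * j C j) (suc (m + k) C suc k) ⟩
    2 ^ k * (2 * (2 * j + 1) * (2 * j C j)) * (suc k * (suc (m + k) C suc k))
      ≡⟨ cong₂ (λ u v → 2 ^ k * u * v) (sym (centralBinomial-suc j)) ([k+1]*[n+1]C[k+1]≡[n+1]*nCk (m + k) k) ⟩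
    2 ^ k * (suc j * (2 * suc j C suc j)) * (suc (m + k) * ((m + k) C k))
      ≡⟨ rearrange₂ j (m + k) (2 ^ k) (2 * suc j C suc j) ((m + k) C k) ⟩
    suc j * suc (m + k) * (2 ^ k * (2 * suc j C suc j) * ((m + k) C k))
      ≡⟨ cong (suc j * suc (m + k) *_) (weight-explicit k (suc j) (trans (+-suc k j) 1+k+j≡m)) ⟨
    suc j * suc (m + k) * weight m k ∎
    where
    open ≡-Reasoning
    rearrange₁ : ∀ k j t b c →
      suc k * (2 * j + 1) * (2 * t * b * c) ≡ t * (2 * (2 * j + 1) * b) * (suc k * c)
    rearrange₁ = solve-∀
    rearrange₂ : ∀ j n t b c → t * (suc j * b) * (suc n * c) ≡ suc j * suc n * (t * b * c)
    rearrange₂ = solve-∀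

  absorptionℤ : ∀ n k → + suc k ℤ.* + (n C suc k) ≡ (+ n ℤ.- + k) ℤ.* + (n C k)
  absorptionℤ n k = begin
    + suc k ℤ.* + (n C suc k)
      ≡⟨ ℤ.pos-* (suc k) (n C suc k) ⟨
    + (suc k * (n C suc k))
      ≡⟨ addSub (+ (suc k * (n C suc k))) (+ (k * (n C k))) ⟩
    + (suc k * (n C suc k) + k * (n C k)) ℤ.- + (k * (n C k))
      ≡⟨ cong (λ t → + t ℤ.- + (k * (n C k))) ([k+1]*nC[k+1]+k*nCk≡n*nCk n k) ⟩
    + (n * (n C k)) ℤ.- + (k * (n C k))
      ≡⟨ cong₂ ℤ._-_ (ℤ.pos-* n (n C k)) (ℤ.pos-* k (n C k)) ⟩
    + n ℤ.* + (n C k) ℤ.- + k ℤ.* + (n C k)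
      ≡⟨ distrib (+ n) (+ k) (+ (n C k)) ⟩
    (+ n ℤ.- + k) ℤ.* + (n C k) ∎
    where
    open ≡-Reasoning
    addSub : ∀ a b → a ≡ a ℤ.+ b ℤ.- b
    addSub = ℤ-Tactic.solve-∀
    distrib : ∀ n k c → n ℤ.* c ℤ.- k ℤ.* c ≡ (n ℤ.- k) ℤ.* c
    distrib = ℤ-Tactic.solve-∀

  module _ (m i : ℕ) where
    open ≡-Reasoning

    private
      α β γ : ℤ
      α = (+ m ℤ.- + i) ℤ.* (+ m ℤ.+ + i ℤ.+ + 1)
      β = (+ 1 ℤ.+ + i) ℤ.* (+ 2 ℤ.+ + i)
      γ = (+ 2 ℤ.* + m ℤ.+ + 1) ℤ.* (+ 1 ℤ.+ + i)

      P : ℕ → ℕ → ℤ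
      P l n = + partialSum m (l + i) n

      w : ℕ → ℤ
      w k = + weight m k

      P-suc : ∀ l n → P l (suc n) ≡ P l n ℤ.+ w n ℤ.* + (n C (l + i))
      P-suc l n = trans
        (cong +_ (sum-applyUpTo-suc (λ k → weight m k * (k C (l + i))) n))
        (cong (λ t → P l n ℤ.+ t) (ℤ.pos-* (weight m n) (n C (l + i))))

      -- With w_k the k-th weight, (k + 1)(2m - 2k - 1) w_{k+1} = (m - k)(m + k + 1) w_k makes the k-th
      -- summand of the recurrence the difference of two consecutive boundary terms; here j = m - n.
      boundary : ℕ → ℕ → ℤ
      boundary n j = + j ℤ.* (+ m ℤ.+ + n ℤ.+ + 1) ℤ.* (w n ℤ.* + (n C i))

      -- Re-expresses the term leaving step n through the weight and binomial of step n + 1, so that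
      -- it can enter the next summand as a multiple of `w (suc n)`.
      boundary-suc : ∀ n j → suc n + j ≡ m →
        boundary n (suc j) ≡ (+ 2 ℤ.* + j ℤ.+ + 1) ℤ.* w (suc n) ℤ.* ((+ 1 ℤ.+ + i) ℤ.* + (suc n C suc i))
      boundary-suc n j eq = begin
        + suc j ℤ.* (+ m ℤ.+ + n ℤ.+ + 1) ℤ.* (w n ℤ.* + (n C i))
          ≡⟨ cong (λ t → + suc j ℤ.* t ℤ.* (w n ℤ.* + (n C i))) (ℤ.+-comm (+ m ℤ.+ + n) (+ 1)) ⟩
        + suc j ℤ.* + suc (m + n) ℤ.* (w n ℤ.* + (n C i))
          ≡⟨ ℤ.*-assoc (+ suc j ℤ.* + suc (m + n)) (w n) (+ (n C i)) ⟨
        + suc j ℤ.* + suc (m + n) ℤ.* w n ℤ.* + (n C i)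
          ≡⟨ cong (ℤ._* + (n C i)) weights ⟩
        + suc n ℤ.* (+ 2 ℤ.* + j ℤ.+ + 1) ℤ.* w (suc n) ℤ.* + (n C i)
          ≡⟨ rearrange (+ suc n) (+ j) (w (suc n)) (+ (n C i)) ⟩
        (+ 2 ℤ.* + j ℤ.+ + 1) ℤ.* w (suc n) ℤ.* (+ suc n ℤ.* + (n C i))
          ≡⟨ cong ((+ 2 ℤ.* + j ℤ.+ + 1) ℤ.* w (suc n) ℤ.*_) binomials ⟩
        (+ 2 ℤ.* + j ℤ.+ + 1) ℤ.* w (suc n) ℤ.* (+ suc i ℤ.* + (suc n C suc i)) ∎
        where
        rearrange : ∀ n j w u → n ℤ.* (+ 2 ℤ.* j ℤ.+ + 1) ℤ.* w ℤ.* u ≡ (+ 2 ℤ.* j ℤ.+ + 1) ℤ.* w ℤ.* (n ℤ.* u)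
        rearrange = ℤ-Tactic.solve-∀

        weights : + suc j ℤ.* + suc (m + n) ℤ.* w n ≡ + suc n ℤ.* (+ 2 ℤ.* + j ℤ.+ + 1) ℤ.* w (suc n)
        weights = begin
          + suc j ℤ.* + suc (m + n) ℤ.* w n             ≡⟨ cong (ℤ._* w n) (ℤ.pos-* (suc j) (suc (m + n))) ⟨
          + (suc j * suc (m + n)) ℤ.* w n               ≡⟨ ℤ.pos-* (suc j * suc (m + n)) (weight m n) ⟨
          + (suc j * suc (m + n) * weight m n)          ≡⟨ cong +_ (weight-suc n j eq) ⟨
          + (suc n * (2 * j + 1) * weight m (suc n))    ≡⟨ ℤ.pos-* (suc n * (2 * j + 1)) (weight m (suc n)) ⟩
          + (suc n * (2 * j + 1)) ℤ.* w (suc n)         ≡⟨ cong (ℤ._* w (suc n)) (ℤ.pos-* (suc n) (2 * j + 1)) ⟩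
          + suc n ℤ.* (+ (2 * j) ℤ.+ + 1) ℤ.* w (suc n)
            ≡⟨ cong (λ t → + suc n ℤ.* (t ℤ.+ + 1) ℤ.* w (suc n)) (ℤ.pos-* 2 j) ⟩
          + suc n ℤ.* (+ 2 ℤ.* + j ℤ.+ + 1) ℤ.* w (suc n) ∎

        binomials : + suc n ℤ.* + (n C i) ≡ + suc i ℤ.* + (suc n C suc i)
        binomials = begin
          + suc n ℤ.* + (n C i)         ≡⟨ ℤ.pos-* (suc n) (n C i) ⟨
          + (suc n * (n C i))           ≡⟨ cong +_ ([k+1]*[n+1]C[k+1]≡[n+1]*nCk n i) ⟨
          + (suc i * (suc n C suc i))   ≡⟨ ℤ.pos-* (suc i) (suc n C suc i) ⟩
          + suc i ℤ.* + (suc n C suc i) ∎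

      -- All terms share the factor `w n`, and absorption links the three neighbouring binomials, so
      -- a polynomial identity in n, j and i remains. The third term on the left is the incoming
      -- boundary term.
      summand : ∀ n j → n + j ≡ m →
        α ℤ.* (w n ℤ.* + (n C i)) ℤ.+ β ℤ.* (w n ℤ.* + (n C (2 + i)))
          ℤ.+ (+ 2 ℤ.* + j ℤ.+ + 1) ℤ.* w n ℤ.* ((+ 1 ℤ.+ + i) ℤ.* + (n C suc i))
        ≡ γ ℤ.* (w n ℤ.* + (n C (1 + i))) ℤ.+ boundary n j
      summand n j refl = trans
        (eliminate (+ n) (+ j) (+ i) (w n) (+ (n C i)) (+ (n C suc i)) (+ (n C suc (suc i))))
        (trans (cancelEq _ (w n ℤ.* (ℤ.- (+ n) ℤ.- + 1 ℤ.- + i)) (absorptionℤ n i))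
               (cancelEq _ ((+ 1 ℤ.+ + i) ℤ.* w n) (absorptionℤ n (suc i))))
        where
        eliminate : ∀ n j i w u v z →
          (n ℤ.+ j ℤ.- i) ℤ.* (n ℤ.+ j ℤ.+ i ℤ.+ + 1) ℤ.* (w ℤ.* u)
            ℤ.+ (+ 1 ℤ.+ i) ℤ.* (+ 2 ℤ.+ i) ℤ.* (w ℤ.* z)
            ℤ.+ (+ 2 ℤ.* j ℤ.+ + 1) ℤ.* w ℤ.* ((+ 1 ℤ.+ i) ℤ.* v)
          ≡ (+ 2 ℤ.* (n ℤ.+ j) ℤ.+ + 1) ℤ.* (+ 1 ℤ.+ i) ℤ.* (w ℤ.* v)
              ℤ.+ j ℤ.* (n ℤ.+ j ℤ.+ n ℤ.+ + 1) ℤ.* (w ℤ.* u)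
            ℤ.+ (+ 1 ℤ.+ i) ℤ.* w ℤ.* ((+ 2 ℤ.+ i) ℤ.* z ℤ.- (n ℤ.- (+ 1 ℤ.+ i)) ℤ.* v)
            ℤ.+ w ℤ.* (ℤ.- n ℤ.- + 1 ℤ.- i) ℤ.* ((+ 1 ℤ.+ i) ℤ.* v ℤ.- (n ℤ.- i) ℤ.* u)
        eliminate = ℤ-Tactic.solve-∀

      telescope : ∀ n j → n + j ≡ m →
        α ℤ.* P 0 (suc n) ℤ.+ β ℤ.* P 2 (suc n) ≡ γ ℤ.* P 1 (suc n) ℤ.+ boundary n j
      telescope n j eq = begin
        α ℤ.* P 0 (suc n) ℤ.+ β ℤ.* P 2 (suc n)
          ≡⟨ cong₂ (λ a b → α ℤ.* a ℤ.+ β ℤ.* b) (P-suc 0 n) (P-suc 2 n) ⟩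
        α ℤ.* (P 0 n ℤ.+ s 0) ℤ.+ β ℤ.* (P 2 n ℤ.+ s 2)
          ≡⟨ split α β γ (P 0 n) (s 0) (P 2 n) (s 2) (P 1 n) t ⟩
        (α ℤ.* P 0 n ℤ.+ β ℤ.* P 2 n ℤ.- (γ ℤ.* P 1 n ℤ.+ t)) ℤ.+ (α ℤ.* s 0 ℤ.+ β ℤ.* s 2 ℤ.+ t) ℤ.+ γ ℤ.* P 1 n
          ≡⟨ cong₂ (λ a b → a ℤ.+ b ℤ.+ γ ℤ.* P 1 n) (ℤ.i≡j⇒i-j≡0 (previous n j eq)) (summand n j eq) ⟩
        0ℤ ℤ.+ (γ ℤ.* s 1 ℤ.+ boundary n j) ℤ.+ γ ℤ.* P 1 n
          ≡⟨ join γ (s 1) (boundary n j) (P 1 n) ⟩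
        γ ℤ.* (P 1 n ℤ.+ s 1) ℤ.+ boundary n j
          ≡⟨ cong (λ a → γ ℤ.* a ℤ.+ boundary n j) (P-suc 1 n) ⟨
        γ ℤ.* P 1 (suc n) ℤ.+ boundary n j ∎
        where
        s : ℕ → ℤ
        s l = w n ℤ.* + (n C (l + i))

        t : ℤ
        t = (+ 2 ℤ.* + j ℤ.+ + 1) ℤ.* w n ℤ.* ((+ 1 ℤ.+ + i) ℤ.* + (n C suc i))

        split : ∀ α β γ a s b s′ c t → α ℤ.* (a ℤ.+ s) ℤ.+ β ℤ.* (b ℤ.+ s′)
          ≡ (α ℤ.* a ℤ.+ β ℤ.* b ℤ.- (γ ℤ.* c ℤ.+ t)) ℤ.+ (α ℤ.* s ℤ.+ β ℤ.* s′ ℤ.+ t) ℤ.+ γ ℤ.* c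
        split = ℤ-Tactic.solve-∀

        join : ∀ γ s b c → 0ℤ ℤ.+ (γ ℤ.* s ℤ.+ b) ℤ.+ γ ℤ.* c ≡ γ ℤ.* (c ℤ.+ s) ℤ.+ b
        join = ℤ-Tactic.solve-∀

        previous : ∀ n j → n + j ≡ m → α ℤ.* P 0 n ℤ.+ β ℤ.* P 2 n ≡
          γ ℤ.* P 1 n ℤ.+ (+ 2 ℤ.* + j ℤ.+ + 1) ℤ.* w n ℤ.* ((+ 1 ℤ.+ + i) ℤ.* + (n C suc i))
        -- Nothing enters at n = 0, because C(0, i + 1) = 0.
        previous zero j _ = zeros α β γ ((+ 2 ℤ.* + j ℤ.+ + 1) ℤ.* w 0) (+ 1 ℤ.+ + i)
          where
          zeros : ∀ α β γ a b → α ℤ.* 0ℤ ℤ.+ β ℤ.* 0ℤ ≡ γ ℤ.* 0ℤ ℤ.+ a ℤ.* (b ℤ.* 0ℤ)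
          zeros = ℤ-Tactic.solve-∀
        previous (suc n) j eq = trans
          (telescope n (suc j) (trans (+-suc n j) eq))
          (cong (λ t → γ ℤ.* P 1 (suc n) ℤ.+ t) (boundary-suc n j eq))

    numer-recurrence :
      (+ m ℤ.- + i) ℤ.* (+ m ℤ.+ + i ℤ.+ + 1) ℤ.* + numer m i
        ℤ.+ (+ 1 ℤ.+ + i) ℤ.* (+ 2 ℤ.+ + i) ℤ.* + numer m (2 + i)
      ≡ (+ 2 ℤ.* + m ℤ.+ + 1) ℤ.* (+ 1 ℤ.+ + i) ℤ.* + numer m (1 + i)
    numer-recurrence
      rewrite numer≡partialSum m i | numer≡partialSum m (1 + i) | numer≡partialSum m (2 + i) =
      -- At n = m the outgoing boundary term has the factor j = 0.
      trans (telescope m 0 (+-identityʳ m)) (ℤ.+-identityʳ (γ ℤ.* P 1 (suc m)))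

  numer-zero : ∀ {m i} → m < i → numer m i ≡ 0
  numer-zero {m} {i} m<i =
    cong (λ l → sum (applyUpTo (λ j → weight m (i + j) * ((i + j) C i)) l)) (m≤n⇒m∸n≡0 m<i)

  weight>0 : ∀ {m k} → k ≤ m → 0 < weight m k
  weight>0 {m} {k} k≤m = *-mono-< (*-mono-< (m^n>0 2 k) (k≤n⇒nCk>0 m∸k≤2m∸2k)) (k≤n⇒nCk>0 (m≤n+m k m))
    where
    m∸k≤2m∸2k : m ∸ k ≤ 2 * m ∸ 2 * k
    m∸k≤2m∸2k = subst (m ∸ k ≤_) (*-distribˡ-∸ 2 m k) (m≤m+n (m ∸ k) _)

  -- The summand k = i is already positive; the rewrite exposes it as the head of a nonempty sum.
  numer>0 : ∀ {m i} → i ≤ m → 0 < numer m i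
  numer>0 {m} {i} i≤m rewrite +-∸-assoc 1 i≤m = ≤-trans
    (*-mono-< (weight>0 (subst (_≤ m) (sym (+-identityʳ i)) i≤m)) (k≤n⇒nCk>0 (m≤m+n i 0)))
    (m≤m+n (weight m (i + 0) * ((i + 0) C i)) _)

  -- For n = m - i and t_i = (i + 1) d_{i+1}(m) / d_i(m): t_i ≤ n and n (2i + 2) / (2i + 3) ≤ t_i.
  RatioBounds : ℕ → ℕ → ℕ → Set
  RatioBounds m i n =
      (0ℤ ℤ.≤ + n ℤ.* + numer m i ℤ.- (+ 1 ℤ.+ + i) ℤ.* + numer m (1 + i))
    × (0ℤ ℤ.≤ (+ 2 ℤ.* + i ℤ.+ + 3) ℤ.* + numer m (1 + i) ℤ.- + 2 ℤ.* + n ℤ.* + numer m i)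

  ratioBounds : ∀ m n i → n + i ≡ m → RatioBounds m i n
  ratioBounds m zero i refl rewrite numer-zero {i} {suc i} ≤-refl =
    ℤ.≤-reflexive (eq₁ (+ numer i i) (+ i)) , ℤ.≤-reflexive (eq₂ (+ numer i i) (+ i))
    where
    eq₁ : ∀ s i → 0ℤ ≡ 0ℤ ℤ.* s ℤ.- (+ 1 ℤ.+ i) ℤ.* 0ℤ
    eq₁ = ℤ-Tactic.solve-∀
    eq₂ : ∀ s i → 0ℤ ≡ (+ 2 ℤ.* i ℤ.+ + 3) ℤ.* 0ℤ ℤ.- + 2 ℤ.* 0ℤ ℤ.* s
    eq₂ = ℤ-Tactic.solve-∀
  ratioBounds m (suc n) i refl with upper , lower ← ratioBounds m n (suc i) (+-suc n i) =
      -- The cancelled factor is m + i + 1, the coefficient left after n + 1 = m - i is absorbed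
      -- into the slack.
      0≤-cancelˡ (n + i + suc i)
        (subst (0ℤ ℤ.≤_) (trans (sym (cancelEq _ (+ 1) rec)) (eqU (+ n) (+ i) a b c))
          (0≤* (0≤+n {1 + i}) (ℤ.+-mono-≤ (0≤+n {numer m (1 + i)}) upper)))
    -- The new lower slack times (m + i + 1)(2i + 5) is 2(i + 1)(i + 2) times the old one plus the
    -- surplus 3 n b. The 3 is (2i + 2)(2i + 4) - (2i + 1)(2i + 5), so the bound reproduces itself
    -- for every i.
    , 0≤-cancelˡ (n + i + suc i)
        (0≤-cancelˡ (4 + (i + i))
        (subst (0ℤ ℤ.≤_) (trans (sym (cancelEq _ (+ 2 ℤ.* (+ 5 ℤ.+ (+ i ℤ.+ + i))) (sym rec))) (eqL (+ n) (+ i) a b c))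
          (ℤ.+-mono-≤ (0≤* (0≤* (0≤+n {3}) (0≤+n {n})) (0≤+n {numer m (1 + i)}))
               (0≤* (0≤* (0≤* (0≤+n {2}) (0≤+n {1 + i})) (0≤+n {2 + i})) lower))))
    where
    a b c : ℤ
    a = + numer m i
    b = + numer m (1 + i)
    c = + numer m (2 + i)
    rec = numer-recurrence m i
    eqU : ∀ n i a b c →
      (+ 1 ℤ.+ i) ℤ.* (b ℤ.+ (n ℤ.* b ℤ.- (+ 1 ℤ.+ (+ 1 ℤ.+ i)) ℤ.* c))
      ℤ.+ + 1 ℤ.* (((+ 1 ℤ.+ n ℤ.+ i) ℤ.- i) ℤ.* ((+ 1 ℤ.+ n ℤ.+ i) ℤ.+ i ℤ.+ + 1) ℤ.* a
                      ℤ.+ (+ 1 ℤ.+ i) ℤ.* (+ 2 ℤ.+ i) ℤ.* c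
                    ℤ.- (+ 2 ℤ.* (+ 1 ℤ.+ n ℤ.+ i) ℤ.+ + 1) ℤ.* (+ 1 ℤ.+ i) ℤ.* b)
      ≡ (+ 1 ℤ.+ (n ℤ.+ i ℤ.+ (+ 1 ℤ.+ i))) ℤ.* ((+ 1 ℤ.+ n) ℤ.* a ℤ.- (+ 1 ℤ.+ i) ℤ.* b)
    eqU = ℤ-Tactic.solve-∀
    eqL : ∀ n i a b c →
      + 3 ℤ.* n ℤ.* b ℤ.+ + 2 ℤ.* (+ 1 ℤ.+ i) ℤ.* (+ 2 ℤ.+ i) ℤ.* ((+ 2 ℤ.* (+ 1 ℤ.+ i) ℤ.+ + 3) ℤ.* c ℤ.- + 2 ℤ.* n ℤ.* b)
      ℤ.+ + 2 ℤ.* (+ 5 ℤ.+ (i ℤ.+ i)) ℤ.* ((+ 2 ℤ.* (+ 1 ℤ.+ n ℤ.+ i) ℤ.+ + 1) ℤ.* (+ 1 ℤ.+ i) ℤ.* b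
        ℤ.- (((+ 1 ℤ.+ n ℤ.+ i) ℤ.- i) ℤ.* ((+ 1 ℤ.+ n ℤ.+ i) ℤ.+ i ℤ.+ + 1) ℤ.* a
                      ℤ.+ (+ 1 ℤ.+ i) ℤ.* (+ 2 ℤ.+ i) ℤ.* c))
      ≡ (+ 5 ℤ.+ (i ℤ.+ i)) ℤ.* ((+ 1 ℤ.+ (n ℤ.+ i ℤ.+ (+ 1 ℤ.+ i))) ℤ.* ((+ 2 ℤ.* i ℤ.+ + 3) ℤ.* b ℤ.- + 2 ℤ.* (+ 1 ℤ.+ n) ℤ.* a))
    eqL = ℤ-Tactic.solve-∀

open Numerators

-- Positivity and strict log-concavity of the integer Turán expressions.

module TuránNumerators where
  open import Data.Integer.Base using (_+_; _*_; _-_; _≤_; _<_; +<+)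

  numerℤ : ℕ → ℤ → ℤ
  numerℤ m -[1+ _ ] = 0ℤ
  numerℤ m (+ i)    = + numer m i

  turánNumer : ℕ → ℤ → ℤ
  turánNumer m i = numerℤ m i * numerℤ m i - numerℤ m (i - + 1) * numerℤ m (i + + 1)

  turánNumer-suc : ∀ m j → turánNumer m (+ suc j) ≡
    + numer m (suc j) * + numer m (suc j) - + numer m j * + numer m (2 ℕ.+ j)
  turánNumer-suc m j =
    cong (λ k → + numer m (suc j) * + numer m (suc j) - + numer m j * + numer m k) (ℕ.+-comm (suc j) 1)

  -- The lower bound at j bounds a₁ and the upper bound at j + 1 bounds a₃, both by multiples of a₂.
  -- Their product leaves the margin 2(n + 1)(j + 2) - (2j + 3) n = n + 2j + 4, the coefficient of
  -- a₂² in `certificate`.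
  turánNumer>0 : ∀ {m i} → i ℕ.≤ m → 0ℤ < turánNumer m (+ i)
  turánNumer>0 {m} {zero} _ = subst (0ℤ <_) (sym (ℤ.+-identityʳ _)) (0<* 0<a 0<a)
    where
    0<a : 0ℤ < + numer m 0
    0<a = +<+ (numer>0 {m} ℕ.z≤n)
  turánNumer>0 {m} {suc j} 1+j≤m = subst (0ℤ <_) (sym (turánNumer-suc m j))
    (ℤ.*-cancelˡ-<-nonNeg (+ 2 * (+ 1 + + n) * (+ 2 + + j))
      (subst₂ _<_ (sym (ℤ.*-zeroʳ (+ 2 * (+ 1 + + n) * (+ 2 + + j)))) (sym (certificate (+ j) (+ n) a₁ a₂ a₃))
        (ℤ.+-mono-<-≤ (ℤ.+-mono-<-≤ (0<* {+ 4 + + n + (+ j + + j)} (+<+ (ℕ.s≤s ℕ.z≤n)) (0<* 0<a₂ 0<a₂))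
          (0≤* (0≤* 0≤2j+3 (0≤+n {numer m (suc j)})) (proj₁ (ratioBounds m n (suc j) n+1+j≡m))))
          (0≤* (proj₂ (ratioBounds m (suc n) j (trans (sym (ℕ.+-suc n j)) n+1+j≡m)))
               (0≤* {+ 2 + + j} 0≤+n (0≤+n {numer m (2 ℕ.+ j)}))))))
    where
    n = m ℕ.∸ suc j
    n+1+j≡m : n ℕ.+ suc j ≡ m
    n+1+j≡m = ℕ.m∸n+n≡m 1+j≤m
    a₁ a₂ a₃ : ℤ
    a₁ = + numer m j
    a₂ = + numer m (suc j)
    a₃ = + numer m (2 ℕ.+ j)
    0≤2j+3 : 0ℤ ≤ + 2 * + j + + 3
    0≤2j+3 = ℤ.+-mono-≤ (0≤* {+ 2} {+ j} 0≤+n 0≤+n) (0≤+n {3})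
    0<a₂ : 0ℤ < a₂
    0<a₂ = +<+ (numer>0 1+j≤m)
    certificate : ∀ j n a₁ a₂ a₃ → + 2 * (+ 1 + n) * (+ 2 + j) * (a₂ * a₂ - a₁ * a₃) ≡
      (+ 4 + n + (j + j)) * (a₂ * a₂)
      + (+ 2 * j + + 3) * a₂ * (n * a₂ - (+ 1 + (+ 1 + j)) * a₃)
      + ((+ 2 * j + + 3) * a₂ - + 2 * (+ 1 + n) * a₁) * ((+ 2 + j) * a₃)
    certificate = ℤ-Tactic.solve-∀

  -- The coefficients enter through equations, so that each use can supply them in the parameters j
  -- and y of the quartic form.
  recurrence-solved : ∀ m i {k₀ k₁ k₂ k₃} →
    k₀ ≡ (+ m - + i) * (+ m + + i + + 1) → k₁ ≡ + 1 + + i → k₂ ≡ + 2 * + m + + 1 → k₃ ≡ + 2 + + i →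
    k₀ * + numer m i ≡ k₁ * (k₂ * + numer m (1 ℕ.+ i) - k₃ * + numer m (2 ℕ.+ i))
  recurrence-solved m i refl refl refl refl = trans
    (rearrange (+ m) (+ i) (+ numer m i) (+ numer m (1 ℕ.+ i)) (+ numer m (2 ℕ.+ i)))
    (cancelEq _ (+ 1) (numer-recurrence m i))
    where
    rearrange : ∀ m i a b c → (m - i) * (m + i + + 1) * a ≡
      (+ 1 + i) * ((+ 2 * m + + 1) * b - (+ 2 + i) * c)
      + + 1 * ((m - i) * (m + i + + 1) * a + (+ 1 + i) * (+ 2 + i) * c - (+ 2 * m + + 1) * (+ 1 + i) * b)
    rearrange = ℤ-Tactic.solve-∀

  turánNumer-logConcave : ∀ {m j} → suc j ℕ.< m →
    turánNumer m (+ j) * turánNumer m (+ suc (suc j)) < turánNumer m (+ suc j) * turánNumer m (+ suc j)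
  turánNumer-logConcave {m} {j} 2+j≤m = go (m ℕ.∸ suc (suc j)) j
    (trans (cong (2 ℕ.+_) (ℕ.+-comm (m ℕ.∸ suc (suc j)) j)) (ℕ.m+[n∸m]≡n 2+j≤m))
    where
    -- With y as a parameter, m becomes a sum and no truncated subtraction reaches the ring solver.
    go : ∀ y j → 2 ℕ.+ (y ℕ.+ j) ≡ m →
      turánNumer m (+ j) * turánNumer m (+ suc (suc j)) < turánNumer m (+ suc j) * turánNumer m (+ suc j)
    go y j refl = subst₂ _<_
      (cong₂ _*_ (cong (λ k → a j * a j - a₋₁ j * a k) (ℕ.+-comm 1 j)) (sym (turánNumer-suc m (suc j))))
      (cong₂ _*_ (sym (turánNumer-suc m j)) (sym (turánNumer-suc m j)))
      (turánProduct<turán² j y (rec₀ j)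
        (recurrence-solved m j (coeff₁ (+ j) (+ y)) refl refl (1+k+1 (+ j)))
        (recurrence-solved m (suc j) (coeff₂ (+ j) (+ y)) (1+k+1 (+ j)) refl (1+k+2 (+ j)))
        (subst (0ℤ ≤_) (lower (+ j) (+ y) (a j) (a (suc j))) (proj₂ bounds))
        (proj₁ bounds)
        (+<+ (numer>0 1+j≤m)))
      where
      a : ℕ → ℤ
      a k = + numer m k

      a₋₁ : ℕ → ℤ
      a₋₁ k = numerℤ m (+ k - + 1)

      1+j≤m : suc j ℕ.≤ m
      1+j≤m = ℕ.s≤s (ℕ.m≤n⇒m≤1+n (ℕ.m≤n+m j y))

      bounds = ratioBounds m (2 ℕ.+ y) j refl

      lower : ∀ j y a b → (+ 2 * j + + 3) * b - + 2 * (+ 2 + y) * a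
        ≡ (+ 2 * (+ 1 + j) + + 1) * b - + 2 * (+ 2 + y) * a
      lower = ℤ-Tactic.solve-∀

      1+k+1 : ∀ k → + 1 + k + + 1 ≡ + 2 + k
      1+k+1 = ℤ-Tactic.solve-∀
      1+k+2 : ∀ k → + 1 + k + + 2 ≡ + 2 + (+ 1 + k)
      1+k+2 = ℤ-Tactic.solve-∀

      coeff₀ : ∀ k y → let m = + 2 + (y + (+ 1 + k)) in
        (+ 2 + y + + 1) * (+ 2 * (+ 1 + (+ 1 + k)) + y) ≡ (m - k) * (m + k + + 1)
      coeff₀ = ℤ-Tactic.solve-∀
      coeff₁ : ∀ j y → let m = + 2 + (y + j) in
        (+ 2 + y) * (+ 2 * (+ 1 + j) + y + + 1) ≡ (m - j) * (m + j + + 1)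
      coeff₁ = ℤ-Tactic.solve-∀
      coeff₂ : ∀ j y → let m = + 2 + (y + j) in
        (+ 2 + y - + 1) * (+ 2 * (+ 1 + j) + (+ 2 + y)) ≡ (m - (+ 1 + j)) * (m + (+ 1 + j) + + 1)
      coeff₂ = ℤ-Tactic.solve-∀

      rec₀ : ∀ j → let m = 2 ℕ.+ (y ℕ.+ j); i = + 1 + + j; x = + 2 + + y in
        (x + + 1) * (+ 2 * i + + y) * numerℤ m (+ j - + 1)
        ≡ + j * ((+ 2 * (+ 2 + (+ y + + j)) + + 1) * + numer m j - i * + numer m (suc j))
      rec₀ zero    = ℤ.*-zeroʳ ((+ 2 + + y + + 1) * (+ 2 * + 1 + + y))
      rec₀ (suc k) = recurrence-solved (2 ℕ.+ (y ℕ.+ suc k)) k (coeff₀ (+ k) (+ y)) refl refl refl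

open TuránNumerators

-- Transfer to the rationals

import Data.Rational.Base as ℚ
open import Data.Rational.Base
  using (ℚ; 0ℚ; 1ℚ; NonZero; Positive; _/_; _*_; _-_; _÷_; _<_; _≤_; 1/_; toℚᵘ)
open import Data.Rational.Properties
open import Data.Rational.Unnormalised.Base as ℚᵘ using (mkℚᵘ; _≃_; *≡*)
import Data.Rational.Unnormalised.Properties as ℚᵘ
import Data.Rational.Solver as ℚ-Solver

fromℤ : ℤ → ℚ
fromℤ a = a / 1

toℚᵘ-fromℤ : ∀ a → toℚᵘ (fromℤ a) ≃ mkℚᵘ a 0
toℚᵘ-fromℤ a = toℚᵘ-fromℚᵘ (mkℚᵘ a 0)

fromℤ-* : ∀ a b → fromℤ (a ℤ.* b) ≡ fromℤ a * fromℤ b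
fromℤ-* a b = toℚᵘ-injective (begin
  toℚᵘ (fromℤ (a ℤ.* b))              ≈⟨ toℚᵘ-fromℤ (a ℤ.* b) ⟩
  mkℚᵘ a 0 ℚᵘ.* mkℚᵘ b 0              ≈⟨ ℚᵘ.*-cong (toℚᵘ-fromℤ a) (toℚᵘ-fromℤ b) ⟨
  toℚᵘ (fromℤ a) ℚᵘ.* toℚᵘ (fromℤ b)  ≈⟨ toℚᵘ-homo-* (fromℤ a) (fromℤ b) ⟨
  toℚᵘ (fromℤ a * fromℤ b)            ∎)
  where open ℚᵘ.≃-Reasoning

fromℤ-- : ∀ a b → fromℤ (a ℤ.- b) ≡ fromℤ a - fromℤ b
fromℤ-- a b = toℚᵘ-injective (begin
  toℚᵘ (fromℤ (a ℤ.- b))                   ≈⟨ toℚᵘ-fromℤ (a ℤ.- b) ⟩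
  mkℚᵘ (a ℤ.- b) 0                         ≈⟨ *≡* (unit a b) ⟩
  mkℚᵘ a 0 ℚᵘ.- mkℚᵘ b 0                   ≈⟨ ℚᵘ.+-cong (toℚᵘ-fromℤ a) (ℚᵘ.-‿cong (toℚᵘ-fromℤ b)) ⟨
  toℚᵘ (fromℤ a) ℚᵘ.- toℚᵘ (fromℤ b)       ≈⟨ ℚᵘ.+-congʳ (toℚᵘ (fromℤ a)) (toℚᵘ-homo‿- (fromℤ b)) ⟨
  toℚᵘ (fromℤ a) ℚᵘ.+ toℚᵘ (ℚ.- fromℤ b)   ≈⟨ toℚᵘ-homo-+ (fromℤ a) (ℚ.- fromℤ b) ⟨
  toℚᵘ (fromℤ a - fromℤ b)                 ∎)
  where
  open ℚᵘ.≃-Reasoning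
  unit : ∀ a b → (a ℤ.- b) ℤ.* 1ℤ ≡ (a ℤ.* 1ℤ ℤ.+ ℤ.- b ℤ.* 1ℤ) ℤ.* 1ℤ
  unit = ℤ-Tactic.solve-∀

/-fromℤ : ∀ a n .{{_ : ℕ.NonZero n}} → a / n ≡ fromℤ a * (1ℤ / n)
/-fromℤ a n@(suc n-1) = toℚᵘ-injective (begin
  toℚᵘ (a / n)                          ≈⟨ toℚᵘ-fromℚᵘ (mkℚᵘ a n-1) ⟩
  mkℚᵘ a n-1                            ≈⟨ *≡* (trans (cong (λ k → a ℤ.* + k) (ℕ.*-identityˡ n)) (cong (ℤ._* + n) (sym (ℤ.*-identityʳ a)))) ⟩
  mkℚᵘ a 0 ℚᵘ.* mkℚᵘ 1ℤ n-1             ≈⟨ ℚᵘ.*-cong (toℚᵘ-fromℤ a) (toℚᵘ-fromℚᵘ (mkℚᵘ 1ℤ n-1)) ⟨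
  toℚᵘ (fromℤ a) ℚᵘ.* toℚᵘ (1ℤ / n)     ≈⟨ toℚᵘ-homo-* (fromℤ a) (1ℤ / n) ⟨
  toℚᵘ (fromℤ a * (1ℤ / n))             ∎)
  where open ℚᵘ.≃-Reasoning

fromℤ-pos : ∀ {a} → 0ℤ ℤ.< a → Positive (fromℤ a)
fromℤ-pos {+ suc k} _ = normalize-pos (suc k) 1
fromℤ-pos {+ zero}  (ℤ.+<+ ())

*-pos : ∀ p q → Positive p → Positive q → Positive (p * q)
*-pos p q p>0 q>0 = pos*pos⇒pos p {{p>0}} q {{q>0}}

scale : ℕ → ℚ
scale m = (1ℤ / 2 ℕ.^ (2 ℕ.* m)) {{ℕ.m^n≢0 2 (2 ℕ.* m)}}

scale-pos : ∀ m → Positive (scale m)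
scale-pos m = normalize-pos 1 (2 ℕ.^ (2 ℕ.* m)) {{ℕ.m^n≢0 2 (2 ℕ.* m)}}

d≡scaled : ∀ m z → d m z ≡ fromℤ (numerℤ m z) * scale m
d≡scaled m -[1+ _ ] = sym (*-zeroˡ (scale m))
d≡scaled m (+ i)    = /-fromℤ (+ numer m i) (2 ℕ.^ (2 ℕ.* m)) {{ℕ.m^n≢0 2 (2 ℕ.* m)}}

turán-scaled : ∀ s x y z {p q r} → p ≡ fromℤ x * s → q ≡ fromℤ y * s → r ≡ fromℤ z * s →
  p * p - q * r ≡ fromℤ (x ℤ.* x ℤ.- y ℤ.* z) * (s * s)
turán-scaled s x y z refl refl refl = begin
  fromℤ x * s * (fromℤ x * s) - fromℤ y * s * (fromℤ z * s)
    ≡⟨ factor (fromℤ x) (fromℤ y) (fromℤ z) s ⟩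
  (fromℤ x * fromℤ x - fromℤ y * fromℤ z) * (s * s)
    ≡⟨ cong₂ (λ p q → (p - q) * (s * s)) (fromℤ-* x x) (fromℤ-* y z) ⟨
  (fromℤ (x ℤ.* x) - fromℤ (y ℤ.* z)) * (s * s)
    ≡⟨ cong (_* (s * s)) (fromℤ-- (x ℤ.* x) (y ℤ.* z)) ⟨
  fromℤ (x ℤ.* x ℤ.- y ℤ.* z) * (s * s) ∎
  where
  open ≡-Reasoning
  factor : ∀ p q r s → p * s * (p * s) - q * s * (r * s) ≡ (p * p - q * r) * (s * s)
  factor = solve 4 (λ p q r s → p :* s :* (p :* s) :- q :* s :* (r :* s) := (p :* p :- q :* r) :* (s :* s)) refl
    where open ℚ-Solver.+-*-Solver

turán-d≡scaled : ∀ m z → turán (d m) z ≡ fromℤ (turánNumer m z) * (scale m * scale m)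
turán-d≡scaled m z =
  turán-scaled (scale m) (numerℤ m z) (numerℤ m (z ℤ.- + 1)) (numerℤ m (z ℤ.+ + 1))
    (d≡scaled m z) (d≡scaled m (z ℤ.- + 1)) (d≡scaled m (z ℤ.+ + 1))

scale²-pos : ∀ m → Positive (scale m * scale m)
scale²-pos m = *-pos (scale m) (scale m) (scale-pos m) (scale-pos m)

turán-d>0 : ∀ {m i} → i ℕ.≤ m → Positive (turán (d m) (+ i))
turán-d>0 {m} {i} i≤m = subst Positive (sym (turán-d≡scaled m (+ i)))
  (*-pos (fromℤ (turánNumer m (+ i))) (scale m * scale m) (fromℤ-pos (turánNumer>0 i≤m)) (scale²-pos m))

0<p-q⇒q<p : ∀ {p q} → Positive (p - q) → q < p
0<p-q⇒q<p {p} {q} p-q>0 =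
  subst₂ _<_ (+-identityʳ q) (shift p q) (+-monoʳ-< q (positive⁻¹ (p - q) {{p-q>0}}))
  where
  shift : ∀ p q → q ℚ.+ (p - q) ≡ p
  shift = solve 2 (λ p q → q :+ (p :- q) := p) refl
    where open ℚ-Solver.+-*-Solver

turán-d-logConcave : ∀ {m j} → suc j ℕ.< m →
  turán (d m) (+ j) * turán (d m) (+ suc (suc j)) < turán (d m) (+ suc j) * turán (d m) (+ suc j)
turán-d-logConcave {m} {j} 1+j<m = 0<p-q⇒q<p (subst Positive
  (sym (turán-scaled σ b a c
    (turán-d≡scaled m (+ suc j)) (turán-d≡scaled m (+ j)) (turán-d≡scaled m (+ suc (suc j)))))
  (*-pos (fromℤ (b ℤ.* b ℤ.- a ℤ.* c)) (σ * σ) (fromℤ-pos 0<b²-ac) (*-pos σ σ (scale²-pos m) (scale²-pos m))))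
  where
  a b c : ℤ
  a = turánNumer m (+ j)
  b = turánNumer m (+ suc j)
  c = turánNumer m (+ suc (suc j))
  σ = scale m * scale m
  0<b²-ac : 0ℤ ℤ.< b ℤ.* b ℤ.- a ℤ.* c
  0<b²-ac = subst (ℤ._< b ℤ.* b ℤ.- a ℤ.* c) (ℤ.+-inverseʳ (a ℤ.* c))
    (ℤ.+-monoˡ-< (ℤ.- (a ℤ.* c)) (turánNumer-logConcave {m} {j} 1+j<m))

÷-<-÷ : ∀ p q r → Positive q → Positive r → p * r < q * q →
  Σ[ q≢0 ∈ NonZero q ] Σ[ r≢0 ∈ NonZero r ] (p ÷ q) {{q≢0}} < (q ÷ r) {{r≢0}}
÷-<-÷ p q r q>0 r>0 pr<qq = q≢0 , r≢0 ,
  *-cancelʳ-<-nonNeg (q * r) {{pos⇒nonNeg (q * r) {{*-pos q r q>0 r>0}}}} (subst₂ _<_ (sym left) (sym right) pr<qq)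
  where
  open ≡-Reasoning
  instance
    q≢0 = pos⇒nonZero q {{q>0}}
    r≢0 = pos⇒nonZero r {{r>0}}
  left : p ÷ q * (q * r) ≡ p * r
  left = begin
    p * 1/ q * (q * r)   ≡⟨ regroup p (1/ q) q r ⟩
    p * (1/ q * q) * r   ≡⟨ cong (λ t → p * t * r) (*-inverseˡ q) ⟩
    p * 1ℚ * r           ≡⟨ cong (_* r) (*-identityʳ p) ⟩
    p * r                ∎
    where
    regroup : ∀ p s q r → p * s * (q * r) ≡ p * (s * q) * r
    regroup = solve 4 (λ p s q r → p :* s :* (q :* r) := p :* (s :* q) :* r) refl
      where open ℚ-Solver.+-*-Solver
  right : q ÷ r * (q * r) ≡ q * q
  right = begin
    q * 1/ r * (q * r)   ≡⟨ regroup q (1/ r) r ⟩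
    q * (1/ r * r) * q   ≡⟨ cong (λ t → q * t * q) (*-inverseˡ r) ⟩
    q * 1ℚ * q           ≡⟨ cong (_* q) (*-identityʳ q) ⟩
    q * q                ∎
    where
    regroup : ∀ q s r → q * s * (q * r) ≡ q * (s * r) * q
    regroup = solve 3 (λ q s r → q :* s :* (q :* r) := q :* (s :* r) :* q) refl
      where open ℚ-Solver.+-*-Solver

-- Finite sequences and their extension by zero.

d-zero : ∀ {m i} → m ℕ.< i → d m (+ i) ≡ 0ℚ
d-zero {m} {i} m<i = begin
  d m (+ i)                                ≡⟨ d≡scaled m (+ i) ⟩
  fromℤ (+ numer m i) * scale m            ≡⟨ cong (λ n → fromℤ (+ n) * scale m) (numer-zero m<i) ⟩
  0ℚ * scale m                             ≡⟨ *-zeroˡ (scale m) ⟩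
  0ℚ                                       ∎
  where open ≡-Reasoning

extend-∈ : ∀ {n} (a : FinSeq n) (f : ℤ → ℚ) → (∀ i → a i ≡ f (+ toℕ i)) →
  ∀ {i} → i ℕ.≤ n → extend a (+ i) ≡ f (+ i)
extend-∈ {n} a f a≡f {i} i≤n with i ℕ.<? suc n
... | yes i<1+n = trans (a≡f (fromℕ< i<1+n)) (cong (λ k → f (+ k)) (toℕ-fromℕ< i<1+n))
... | no  i≮1+n = contradiction (ℕ.s≤s i≤n) i≮1+n

extend-∉ : ∀ {n} (a : FinSeq n) {i} → n ℕ.< i → extend a (+ i) ≡ 0ℚ
extend-∉ {n} a {i} n<i with i ℕ.<? suc n
... | yes i<1+n = contradiction i<1+n (ℕ.≤⇒≯ n<i)
... | no  _     = refl

extend-borosMoll : ∀ m z → extend (borosMoll m) z ≡ d m z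
extend-borosMoll m -[1+ _ ] = refl
extend-borosMoll m (+ i) with ℕ.≤-<-connex i m
... | inj₁ i≤m = extend-∈ (borosMoll m) (d m) (λ _ → refl) i≤m
... | inj₂ m<i = trans (extend-∉ (borosMoll m) m<i) (sym (d-zero m<i))

turán-cong : ∀ {a b : ℤ → ℚ} → (∀ z → a z ≡ b z) → ∀ z → turán a z ≡ turán b z
turán-cong a≡b z = cong₂ _-_ (cong₂ _*_ (a≡b z) (a≡b z)) (cong₂ _*_ (a≡b (z ℤ.- + 1)) (a≡b (z ℤ.+ + 1)))

extend-𝓛-borosMoll : ∀ {m i} → i ℕ.≤ m → extend (𝓛 (borosMoll m)) (+ i) ≡ turán (d m) (+ i)
extend-𝓛-borosMoll {m} =
  extend-∈ (𝓛 (borosMoll m)) (turán (d m)) (λ i → turán-cong (extend-borosMoll m) (+ toℕ i))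

p≤q⇒0≤q-p : ∀ {p q} → p ≤ q → 0ℚ ≤ q - p
p≤q⇒0≤q-p {p} {q} p≤q = subst (_≤ q - p) (+-inverseʳ p) (+-monoˡ-≤ (ℚ.- p) p≤q)

borosMoll-logConcave : ∀ m → LogConcave (borosMoll m)
borosMoll-logConcave m i _ i≤m = subst (0ℚ ≤_) (sym (turán-cong (extend-borosMoll m) (+ i)))
  (<⇒≤ (positive⁻¹ (turán (d m) (+ i)) {{turán-d>0 i≤m}}))

𝓛-borosMoll-logConcave : ∀ m → LogConcave (𝓛 (borosMoll m))
𝓛-borosMoll-logConcave m (suc j) _ 1+j≤m =
  p≤q⇒0≤q-p (subst (λ k → E (+ j) * E (+ k) ≤ E (+ suc j) * E (+ suc j)) (ℕ.+-comm 1 (suc j)) (bound (ℕ.m≤n⇒m<n∨m≡n 1+j≤m)))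
  where
  E : ℤ → ℚ
  E = extend (𝓛 (borosMoll m))
  j≤m : j ℕ.≤ m
  j≤m = ℕ.≤-trans (ℕ.n≤1+n j) 1+j≤m
  bound : _ → E (+ j) * E (+ suc (suc j)) ≤ E (+ suc j) * E (+ suc j)
  bound (inj₁ 1+j<m) = subst₂ _≤_
    (sym (cong₂ _*_ (extend-𝓛-borosMoll j≤m) (extend-𝓛-borosMoll 1+j<m)))
    (sym (cong₂ _*_ (extend-𝓛-borosMoll 1+j≤m) (extend-𝓛-borosMoll 1+j≤m)))
    (<⇒≤ (turán-d-logConcave 1+j<m))
  -- At the last index, i = m, the right neighbour is the zero of the extension, so the product
  -- vanishes and lies below a square.
  bound (inj₂ refl) = begin
    E (+ j) * E (+ suc m)   ≡⟨ cong (E (+ j) *_) (extend-∉ (𝓛 (borosMoll m)) ℕ.≤-refl) ⟩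
    E (+ j) * 0ℚ            ≡⟨ *-zeroʳ (E (+ j)) ⟩
    0ℚ                      ≤⟨ <⇒≤ (positive⁻¹ (t * t) {{*-pos t t t>0 t>0}}) ⟩
    t * t                   ≡⟨ cong₂ _*_ (extend-𝓛-borosMoll 1+j≤m) (extend-𝓛-borosMoll 1+j≤m) ⟨
    E (+ m) * E (+ m)       ∎
    where
    open ≤-Reasoning
    t = turán (d m) (+ m)
    t>0 = turán-d>0 {m} ℕ.≤-refl

-- The inequality between ratios.

turán-pred : ∀ (a : ℤ → ℚ) z →
  turán a (z ℤ.- + 1) ≡ a (z ℤ.- + 1) * a (z ℤ.- + 1) - a (z ℤ.- + 2) * a z
turán-pred a z = cong₂ (λ u v → a (z ℤ.- + 1) * a (z ℤ.- + 1) - a u * a v) (z-1-1 z) (z-1+1 z)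
  where
  z-1-1 : ∀ z → z ℤ.- + 1 ℤ.- + 1 ≡ z ℤ.- + 2
  z-1-1 = ℤ-Tactic.solve-∀
  z-1+1 : ∀ z → z ℤ.- + 1 ℤ.+ + 1 ≡ z
  z-1+1 = ℤ-Tactic.solve-∀

turán-suc : ∀ (a : ℤ → ℚ) z →
  turán a (z ℤ.+ + 1) ≡ a (z ℤ.+ + 1) * a (z ℤ.+ + 1) - a z * a (z ℤ.+ + 2)
turán-suc a z = cong₂ (λ u v → a (z ℤ.+ + 1) * a (z ℤ.+ + 1) - a u * a v) (z+1-1 z) (z+1+1 z)
  where
  z+1-1 : ∀ z → z ℤ.+ + 1 ℤ.- + 1 ≡ z
  z+1-1 = ℤ-Tactic.solve-∀
  z+1+1 : ∀ z → z ℤ.+ + 1 ℤ.+ + 1 ≡ z ℤ.+ + 2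
  z+1+1 = ℤ-Tactic.solve-∀

turán-ratios : ∀ m i → + 1 ℤ.≤ i → i ℤ.≤ + m ℤ.- + 1 →
  let T₋ = turán (d m) (i ℤ.- + 1); T₀ = turán (d m) i; T₊ = turán (d m) (i ℤ.+ + 1) in
  Σ[ T₀≢0 ∈ NonZero T₀ ] Σ[ T₊≢0 ∈ NonZero T₊ ] (T₋ ÷ T₀) {{T₀≢0}} < (T₀ ÷ T₊) {{T₊≢0}}
turán-ratios m (+ suc j) _ i≤m-1 = subst (λ k → Ratios (turán (d m) (+ k))) (ℕ.+-comm 1 (suc j))
  (÷-<-÷ (turán (d m) (+ j)) (turán (d m) (+ suc j)) (turán (d m) (+ suc (suc j)))
    (turán-d>0 (ℕ.<⇒≤ 1+j<m)) (turán-d>0 1+j<m) (turán-d-logConcave 1+j<m))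
  where
  Ratios : ℚ → Set
  Ratios T₊ = Σ[ T₀≢0 ∈ NonZero (turán (d m) (+ suc j)) ] Σ[ T₊≢0 ∈ NonZero T₊ ]
    (turán (d m) (+ j) ÷ turán (d m) (+ suc j)) {{T₀≢0}} < (turán (d m) (+ suc j) ÷ T₊) {{T₊≢0}}
  1+j<m : suc j ℕ.< m
  1+j<m = ℤ.drop‿+≤+ (subst₂ ℤ._≤_ (ℤ.+-comm (+ suc j) (+ 1)) (m-1+1 (+ m)) (ℤ.+-monoˡ-≤ (+ 1) i≤m-1))
    where
    m-1+1 : ∀ m → m ℤ.- + 1 ℤ.+ + 1 ≡ m
    m-1+1 = ℤ-Tactic.solve-∀
turán-ratios m (+ zero) (ℤ.+≤+ ())

theorem1p4 : (∀ (m : ℕ) → 2 -LogConcave borosMoll m)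
    ×
    (∀ (m : ℕ) (i : ℤ) → + 1 ℤ.≤ i → i ℤ.≤ + m ℤ.- + 1 →
      let D₋ = d m (i ℤ.- + 1) * d m (i ℤ.- + 1) - d m (i ℤ.- + 2) * d m i
          D₀ = d m i * d m i - d m (i ℤ.- + 1) * d m (i ℤ.+ + 1)
          D₊ = d m (i ℤ.+ + 1) * d m (i ℤ.+ + 1) - d m i * d m (i ℤ.+ + 2)
      in Σ[ D₀≢0 ∈ NonZero D₀ ] Σ[ D₊≢0 ∈ NonZero D₊ ]
           (D₋ ÷ D₀) {{D₀≢0}} < (D₀ ÷ D₊) {{D₊≢0}})
theorem1p4 = twoLogConcave , λ m i 1≤i i≤m-1 →
  -- The nonzero proofs depend on the denominators, so the whole Σ-type is transported and not the
  -- inequality alone.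
  subst₂
    (λ D₋ D₊ → let D₀ = turán (d m) i in
      Σ[ D₀≢0 ∈ NonZero D₀ ] Σ[ D₊≢0 ∈ NonZero D₊ ] (D₋ ÷ D₀) {{D₀≢0}} < (D₀ ÷ D₊) {{D₊≢0}})
    (turán-pred (d m) i) (turán-suc (d m) i) (turán-ratios m i 1≤i i≤m-1)
  where
  twoLogConcave : ∀ m → 2 -LogConcave borosMoll m
  twoLogConcave m 0 _ = borosMoll-logConcave m
  twoLogConcave m 1 _ = 𝓛-borosMoll-logConcave m
  twoLogConcave m (suc (suc _)) (ℕ.s≤s (ℕ.s≤s ()))
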